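{- Let $p\ge5$, write $x=p-2$, and consider the black metallic tree $\mathcal B_\rho$ under the rightmost assignment (the last son of each node is black). For a node $\nu$ let $u$ be the nzm-code of $\nu-1$ and $v$ the nzm-code of $\nu-2$. Then the sons of the nodes, in increasing order, have the following nzm-codes: (1) root $\nu=1$: the sons are $h+1$ (one digit) for $h=1,\dots,p-4$, then $x$; (2) black $\nu\neq1$: the sons are $u\,h$ for $h=1,\dots,p-3$; (3) white $\nu$ with nzm-signature $1$ or $x$: first son $v\,x$, then $u\,(h-1)$ for $h=2,\dots,p-2$; (4) white $\nu$ with nzm-signature $a$, $1<a<x$: the sons $u\,h$ for $h=1,\dots,p-3$, then $u\,x$. Moreover: $\mathcal B_\rho$ does not have a preferred son property for the nzm-codes, whatever the digit chosen; for every node $\nu$, the integer whose nzm-code is the nzm-code of $\nu$ followed by $1$ (the successor of $\nu$) is a son of $\nu+1$ in $\mathcal B_\rho$, namely its leftmost son or its second son; and for no assignment $\alpha$ on the black metallic tree and no digit $a\in\{1,\dots,p-2\}$ does every node $\nu$ of $\mathcal B_\alpha$ have exactly one son whose nzm-code is the nzm-code of $\nu$ followed by $a$.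
   Context: Fix $p\ge5$. Metallic numbers: $m_{ -1}=0$, $m_0=1$, $m_{n+2}=(p-2)m_{n+1}-m_n$. With $x=p-2$, $d=p-3$, the nzm-code of a positive integer $n$ is the unique word $a_k\cdots a_0$ over $\{1,\dots,p-2\}$ with $n=\sum a_im_i$ containing no factor $x\,d^j\,x$ ($j\ge0$); its nzm-signature is the last digit $a_0$; $w\,e$ denotes the word $w$ followed by the digit $e$. Black metallic tree under an assignment $\alpha$, $\mathcal B_\alpha$: nodes are the positive integers, each black or white; the root $1$ is black; nodes are processed in increasing order and node $\nu$ receives $p-2$ sons if white and $p-3$ sons if black, namely the smallest integers not yet used, in increasing order; an assignment specifies for each node the position (leftmost $=1$) of its unique black son among its sons, other sons being white. The rightmost assignment $\rho$ puts the black son at the last position. -}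

module Defs where

open import Data.Bool using (Bool; true; false; if_then_else_; _∧_; _∨_)
open import Data.Empty using (⊥-elim)
open import Data.List using (List; []; _∷_; _++_; map; head; replicate; applyUpTo)
open import Data.List.Membership.Propositional using (_∈_)
open import Data.List.NonEmpty as List⁺ using (List⁺; _∷_; _++⁺_)
open import Data.List.Relation.Binary.Infix.Heterogeneous using (Infix; here; there)
open import Data.List.Relation.Binary.Prefix.Heterogeneous using (Prefix; []; _∷_)
open import Data.List.Relation.Unary.All using (All; []; _∷_)
open import Data.Maybe using (Maybe)
open import Data.Nat
open import Data.Nat.Properties
open import Data.Nat.Solver using (module +-*-Solver)
open import Data.Product using (∃-syntax; ∃!; _×_; _,_; proj₁; proj₂)
open import Data.Sum using (_⊎_; inj₁; inj₂)
open import Relation.Binary.Definitions using (tri<; tri≈; tri>)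
open import Relation.Binary.PropositionalEquality
open import Relation.Nullary using (¬_; yes; no; contradiction)

infix 6 _‥_

_‥_ : ℕ → ℕ → List ℕ
lo ‥ hi = applyUpTo (lo +_) (suc hi ∸ lo)

-- A word a_k ⋯ a_0 is stored least significant digit first, as
-- a_0 ∷ ⋯ ∷ a_k ∷ [], so that a_i sits at index i and w ▹ e is the word w
-- followed by the digit e. The forbidden factors x dʲ x are palindromes, hence
-- insensitive to this reversal.
Word : Set
Word = List ℕ

infixl 5 _▹_

_▹_ : Word → ℕ → Word
w ▹ e = e ∷ w

signature : Word → Maybe ℕ
signature = head

data Colour : Set where
  black white : Colour

module Metallic (p : ℕ) (p≥5 : 5 ≤ p) where

  x d : ℕ
  x = p ∸ 2
  d = p ∸ 3

  -- metallic₋₁ n is m_{n-1}. The truncated subtraction is a genuine one, see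
  -- metallic-rec below.
  metallic₋₁ : ℕ → ℕ
  metallic₋₁ 0             = 0
  metallic₋₁ 1             = 1
  metallic₋₁ (suc (suc n)) = (p ∸ 2) * metallic₋₁ (suc n) ∸ metallic₋₁ n

  metallic : ℕ → ℕ
  metallic n = metallic₋₁ (suc n)

  valueFrom : ℕ → Word → ℕ
  valueFrom i []      = 0
  valueFrom i (a ∷ w) = a * metallic i + valueFrom (suc i) w

  value : Word → ℕ
  value = valueFrom 0

  IsDigit : ℕ → Set
  IsDigit a = 1 ≤ a × a ≤ p ∸ 2

  forbidden : ℕ → Word
  forbidden j = x ∷ replicate j d ++ x ∷ []

  -- For n = 0 this is satisfied by the empty word only.
  IsNzmCode : ℕ → Word → Set
  IsNzmCode n w =
    All IsDigit w × value w ≡ n × ¬ (∃[ j ] Infix _≡_ (forbidden j) w)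

  private
    x≡1+d′ : ∀ p → 5 ≤ p → p ∸ 2 ≡ suc (p ∸ 3)
    x≡1+d′ (suc (suc (suc p))) _ = refl
    x≡1+d′ (suc (suc zero)) (s≤s (s≤s ()))
    x≡1+d′ (suc zero) (s≤s ())

    2≤d′ : ∀ p → 5 ≤ p → 2 ≤ p ∸ 3
    2≤d′ (suc (suc (suc p))) (s≤s (s≤s (s≤s 2≤p))) = 2≤p

  x≡1+d : x ≡ suc d
  x≡1+d = x≡1+d′ p p≥5

  2≤d : 2 ≤ d
  2≤d = 2≤d′ p p≥5

  metallic₋₁-mono : ∀ n → metallic₋₁ n ≤ metallic₋₁ (suc n)
  metallic₋₁-mono zero    = z≤n
  metallic₋₁-mono (suc n) = begin
    M₁                 ≡⟨ sym (*-identityˡ M₁) ⟩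
    1 * M₁             ≤⟨ *-monoˡ-≤ M₁ (≤-trans (s≤s z≤n) 2≤d) ⟩
    d * M₁             ≡⟨ sym (m+n∸m≡n M₁ (d * M₁)) ⟩
    suc d * M₁ ∸ M₁    ≡⟨ cong (λ y → y * M₁ ∸ M₁) (sym x≡1+d) ⟩
    x * M₁ ∸ M₁        ≤⟨ ∸-monoʳ-≤ (x * M₁) (metallic₋₁-mono n) ⟩
    x * M₁ ∸ M₀        ∎
    where
    open ≤-Reasoning
    M₀ M₁ : ℕ
    M₀ = metallic₋₁ n
    M₁ = metallic₋₁ (suc n)

  metallic-rec : ∀ n →
    metallic₋₁ (suc (suc n)) + metallic₋₁ n ≡ x * metallic₋₁ (suc n)
  metallic-rec n = m∸n+n≡m (begin
    metallic₋₁ n                 ≤⟨ metallic₋₁-mono n ⟩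
    metallic₋₁ (suc n)           ≤⟨ m≤m+n _ (d * metallic₋₁ (suc n)) ⟩
    suc d * metallic₋₁ (suc n)   ≡⟨ cong (_* metallic₋₁ (suc n)) (sym x≡1+d) ⟩
    x * metallic₋₁ (suc n)       ∎)
    where open ≤-Reasoning

  -- Words without forbidden factor: Free ones can still be followed by x,
  -- Blocked ones end with x dʲ and cannot.
  mutual
    data Free : Word → Set where
      []  : Free []
      low : ∀ {a w} → 1 ≤ a → a < d → Valid w → Free (a ∷ w)
      ext : ∀ {w} → Free w → Free (d ∷ w)

    data Blocked : Word → Set where
      top : ∀ {w} → Free w → Blocked (x ∷ w)
      ext : ∀ {w} → Blocked w → Blocked (d ∷ w)

    Valid : Word → Set
    Valid w = Free w ⊎ Blocked w

  private
    d≢x : d ≢ x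
    d≢x eq = 1+n≢n (sym (trans eq x≡1+d))

    d<x : d < x
    d<x = ≤-reflexive (sym x≡1+d)

    1≤d : 1 ≤ d
    1≤d = ≤-trans (s≤s z≤n) 2≤d

    valid-tail : ∀ {a w} → Valid (a ∷ w) → Valid w
    valid-tail (inj₁ (low _ _ v)) = v
    valid-tail (inj₁ (ext f))     = inj₁ f
    valid-tail (inj₂ (top f))     = inj₁ f
    valid-tail (inj₂ (ext b))     = inj₂ b

    free-prefix : ∀ j {w} → Free w → ¬ Prefix _≡_ (replicate j d ++ x ∷ []) w
    free-prefix zero    (low _ a<d _) (refl ∷ _) = <-asym a<d d<x
    free-prefix zero    (ext _)       (x≡d ∷ _)  = d≢x (sym x≡d)
    free-prefix (suc j) (low _ a<d _) (refl ∷ _) = <-irrefl refl a<d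
    free-prefix (suc j) (ext f)       (_ ∷ q)    = free-prefix j f q

    blocked-prefix : ∀ {w} → Blocked w →
      ∃[ j ] Prefix _≡_ (replicate j d ++ x ∷ []) w
    blocked-prefix (top _) = 0 , refl ∷ []
    blocked-prefix (ext b) with blocked-prefix b
    ... | j , q = suc j , refl ∷ q

    valid-avoids : ∀ j {w} → Valid w → ¬ Infix _≡_ (forbidden j) w
    valid-avoids j (inj₁ [])            (here ())
    valid-avoids j (inj₁ (low _ a<d _)) (here (refl ∷ _)) = <-asym a<d d<x
    valid-avoids j (inj₁ (ext _))       (here (x≡d ∷ _))  = d≢x (sym x≡d)
    valid-avoids j (inj₂ (top f))       (here (_ ∷ q))    = free-prefix j f q
    valid-avoids j (inj₂ (ext _))       (here (x≡d ∷ _))  = d≢x (sym x≡d)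
    valid-avoids j v                    (there i)         =
      valid-avoids j (valid-tail v) i

    valid-digits : ∀ {w} → Valid w → All IsDigit w
    valid-digits {[]}    _ = []
    valid-digits {a ∷ w} v = digit v ∷ valid-digits (valid-tail v)
      where
      digit : ∀ {a w} → Valid (a ∷ w) → IsDigit a
      digit (inj₁ (low 1≤a a<d _)) = 1≤a , <⇒≤ (<-trans a<d d<x)
      digit (inj₁ (ext _))         = 1≤d , <⇒≤ d<x
      digit (inj₂ (top _))         = ≤-trans 1≤d (<⇒≤ d<x) , ≤-refl
      digit (inj₂ (ext _))         = 1≤d , <⇒≤ d<x

  avoiding⇒valid : ∀ w → All IsDigit w →
    ¬ (∃[ j ] Infix _≡_ (forbidden j) w) → Valid w
  avoiding⇒valid []      _                    _  = inj₁ []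
  avoiding⇒valid (a ∷ w) ((1≤a , a≤x) ∷ digs) av
    with avoiding⇒valid w digs (λ (j , i) → av (j , there i)) | <-cmp a d
  ... | v      | tri< a<d _ _    = inj₁ (low 1≤a a<d v)
  ... | inj₁ f | tri≈ _ refl _   = inj₁ (ext f)
  ... | inj₂ b | tri≈ _ refl _   = inj₂ (ext b)
  ... | v      | tri> _ _ d<a
    with ≤-antisym a≤x (≤-trans (≤-reflexive x≡1+d) d<a) | v
  ... | refl | inj₁ f = inj₂ (top f)
  ... | refl | inj₂ b with blocked-prefix b
  ... | j , q = ⊥-elim (av (j , here (refl ∷ q)))

  valid⇒code : ∀ {w} → Valid w → IsNzmCode (value w) w
  valid⇒code v = valid-digits v , refl , λ (j , i) → valid-avoids j v i

  blocked : Word → Bool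
  blocked []      = false
  blocked (a ∷ w) = (a ≡ᵇ x) ∨ ((a ≡ᵇ d) ∧ blocked w)

  next : Word → Word
  next []      = 1 ∷ []
  next (a ∷ w) = if blocked (a ∷ w) then 1 ∷ next w else suc a ∷ w

  private
    ≡ᵇ-refl : ∀ n → (n ≡ᵇ n) ≡ true
    ≡ᵇ-refl zero    = refl
    ≡ᵇ-refl (suc n) = ≡ᵇ-refl n

    <⇒≡ᵇ : ∀ {m n} → m < n → (m ≡ᵇ n) ≡ false
    <⇒≡ᵇ {zero}  (s≤s _)   = refl
    <⇒≡ᵇ {suc m} (s≤s m<n) = <⇒≡ᵇ m<n

  free-unblocked : ∀ {w} → Free w → blocked w ≡ false
  free-unblocked []            = refl
  free-unblocked (low _ a<d _)
    rewrite <⇒≡ᵇ a<d | <⇒≡ᵇ (<-trans a<d d<x) = refl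
  free-unblocked (ext f)
    rewrite <⇒≡ᵇ d<x | ≡ᵇ-refl d = free-unblocked f

  blocked-blocked : ∀ {w} → Blocked w → blocked w ≡ true
  blocked-blocked (top _) rewrite ≡ᵇ-refl x = refl
  blocked-blocked (ext b)
    rewrite <⇒≡ᵇ d<x | ≡ᵇ-refl d = blocked-blocked b

  next-free : ∀ {a w} → Free (a ∷ w) → next (a ∷ w) ≡ suc a ∷ w
  next-free f rewrite free-unblocked f = refl

  next-blocked : ∀ {a w} → Blocked (a ∷ w) → next (a ∷ w) ≡ 1 ∷ next w
  next-blocked b rewrite blocked-blocked b = refl

  next-valid : ∀ {w} → Valid w → Valid (next w)
  next-valid {[]} _ = inj₁ (low ≤-refl 2≤d (inj₁ []))
  next-valid {a ∷ w} (inj₂ b) rewrite blocked-blocked b =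
    inj₁ (low ≤-refl 2≤d (next-valid (valid-tail (inj₂ b))))
  next-valid {a ∷ w} (inj₁ f) rewrite next-free f = bump f
    where
    bump : ∀ {a w} → Free (a ∷ w) → Valid (suc a ∷ w)
    bump (low {a} {w} 1≤a a<d v) with suc a ≟ d | v
    ... | yes 1+a≡d | inj₁ f =
      subst (λ y → Valid (y ∷ w)) (sym 1+a≡d) (inj₁ (ext f))
    ... | yes 1+a≡d | inj₂ b =
      subst (λ y → Valid (y ∷ w)) (sym 1+a≡d) (inj₂ (ext b))
    ... | no  1+a≢d | _      = inj₁ (low (s≤s z≤n) (≤∧≢⇒< a<d 1+a≢d) v)
    bump {w = w} (ext f) = subst (λ y → Valid (y ∷ w)) x≡1+d (inj₂ (top f))

  value-next-free : ∀ i {w} → Free w →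
    valueFrom i (next w) ≡ valueFrom i w + metallic i
  value-next-free i {[]} _ = trans (+-identityʳ _) (+-identityʳ _)
  value-next-free i {a ∷ w} f rewrite next-free f =
    solve 3 (λ a m r → m :+ a :* m :+ r := a :* m :+ r :+ m) refl
      a (metallic i) (valueFrom (suc i) w)
    where open +-*-Solver

  value-next-blocked : ∀ i {w} → Blocked w →
    valueFrom i (next w) + metallic₋₁ i ≡ valueFrom i w + metallic i
  value-next-blocked i {_ ∷ w} (top f)
    rewrite blocked-blocked (top f) | value-next-free (suc i) f = begin
    1 * m + (r + m′) + m₋ ≡⟨ solve 4 (λ m r m′ m₋ →
                               con 1 :* m :+ (r :+ m′) :+ m₋
                               := m′ :+ m₋ :+ r :+ m) refl m r m′ m₋ ⟩
    m′ + m₋ + r + m       ≡⟨ cong (λ y → y + r + m) (metallic-rec i) ⟩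
    x * m + r + m         ∎
    where
    open ≡-Reasoning
    open +-*-Solver
    m m′ m₋ r : ℕ
    m  = metallic i
    m′ = metallic (suc i)
    m₋ = metallic₋₁ i
    r  = valueFrom (suc i) w
  value-next-blocked i {_ ∷ w} (ext b)
    rewrite blocked-blocked (ext b) = begin
    1 * m + s + m₋        ≡⟨ solve 3 (λ m s m₋ →
                               con 1 :* m :+ s :+ m₋ := s :+ m :+ m₋)
                               refl m s m₋ ⟩
    s + m + m₋            ≡⟨ cong (_+ m₋) (value-next-blocked (suc i) b) ⟩
    r + m′ + m₋           ≡⟨ +-assoc r m′ m₋ ⟩
    r + (m′ + m₋)         ≡⟨ cong (r +_) (metallic-rec i) ⟩
    r + x * m             ≡⟨ cong (λ y → r + y * m) x≡1+d ⟩
    r + suc d * m         ≡⟨ solve 3 (λ m r d →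
                               r :+ (m :+ d :* m) := d :* m :+ r :+ m)
                               refl m r d ⟩
    d * m + r + m         ∎
    where
    open ≡-Reasoning
    open +-*-Solver
    m m′ m₋ r s : ℕ
    m  = metallic i
    m′ = metallic (suc i)
    m₋ = metallic₋₁ i
    r  = valueFrom (suc i) w
    s  = valueFrom (suc i) (next w)

  value-next : ∀ {w} → Valid w → value (next w) ≡ suc (value w)
  value-next {w} (inj₁ f) = trans (value-next-free 0 f) (+-comm (value w) 1)
  value-next {w} (inj₂ b) = trans (sym (+-identityʳ _))
    (trans (value-next-blocked 0 b) (+-comm (value w) 1))

  mutual
    valid-pred : ∀ {a w} → Valid (a ∷ w) → ∃[ w₀ ] Valid w₀ × next w₀ ≡ a ∷ w
    valid-pred (inj₁ (low 1≤a a<d v)) = low-pred 1≤a a<d v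
    valid-pred {w = w} (inj₁ (ext f)) =
      pred d ∷ w , inj₁ g , trans (next-free g) (cong (_∷ w) eq)
      where
      eq : suc (pred d) ≡ d
      eq = suc-pred d {{>-nonZero 1≤d}}
      g : Free (pred d ∷ w)
      g = low (pred-mono-≤ 2≤d) (≤-reflexive eq) (inj₁ f)
    valid-pred {w = w} (inj₂ (top f)) =
      d ∷ w , inj₁ (ext f) ,
      trans (next-free (ext f)) (cong (_∷ w) (sym x≡1+d))
    valid-pred {w = w} (inj₂ (ext b)) =
      pred d ∷ w , inj₁ g , trans (next-free g) (cong (_∷ w) eq)
      where
      eq : suc (pred d) ≡ d
      eq = suc-pred d {{>-nonZero 1≤d}}
      g : Free (pred d ∷ w)
      g = low (pred-mono-≤ 2≤d) (≤-reflexive eq) (inj₂ b)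

    low-pred : ∀ {a w} → 1 ≤ a → a < d → Valid w →
      ∃[ w₀ ] Valid w₀ × next w₀ ≡ a ∷ w
    low-pred {suc zero} {[]} _ _ v = [] , v , refl
    low-pred {suc zero} {b ∷ w} _ _ v with valid-pred v
    ... | w₀ , inj₁ f , eq =
      x ∷ w₀ , inj₂ (top f) , trans (next-blocked (top f)) (cong (1 ∷_) eq)
    ... | w₀ , inj₂ b , eq =
      d ∷ w₀ , inj₂ (ext b) , trans (next-blocked (ext b)) (cong (1 ∷_) eq)
    low-pred {suc (suc a)} {w} _ a<d v =
      suc a ∷ w , inj₁ f , next-free f
      where
      f : Free (suc a ∷ w)
      f = low (s≤s z≤n) (<-trans (n<1+n _) a<d) v

  valid-unique : ∀ n {w w′} → Valid w → Valid w′ →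
    value w ≡ n → value w′ ≡ n → w ≡ w′
  valid-unique n {[]} {[]} _ _ _ _ = refl
  valid-unique n {[]} {_ ∷ _} _ v′ refl e′ with valid-pred v′
  ... | _ , v₀′ , eq′ = contradiction
    (trans (sym (value-next v₀′)) (trans (cong value eq′) e′)) λ ()
  valid-unique n {_ ∷ _} {[]} v _ e refl with valid-pred v
  ... | _ , v₀ , eq = contradiction
    (trans (sym (value-next v₀)) (trans (cong value eq) e)) λ ()
  valid-unique zero {_ ∷ _} {_ ∷ _} v _ e _ with valid-pred v
  ... | _ , v₀ , eq =
    contradiction (trans (sym (value-next v₀)) (trans (cong value eq) e)) λ ()
  valid-unique (suc n) {_ ∷ _} {_ ∷ _} v v′ e e′
    with valid-pred v | valid-pred v′
  ... | w₀ , v₀ , eq | w₀′ , v₀′ , eq′ =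
    trans (sym eq) (trans (cong next w₀≡w₀′) eq′)
    where
    w₀≡w₀′ : w₀ ≡ w₀′
    w₀≡w₀′ = valid-unique n v₀ v₀′
      (suc-injective (trans (sym (value-next v₀)) (trans (cong value eq) e)))
      (suc-injective (trans (sym (value-next v₀′)) (trans (cong value eq′) e′)))

  valid-of-value : ∀ n → ∃[ w ] Valid w × value w ≡ n
  valid-of-value zero    = [] , inj₁ [] , refl
  valid-of-value (suc n) with valid-of-value n
  ... | w , v , e = next w , next-valid v , trans (value-next v) (cong suc e)

  nzm-exists-unique : ∀ n → ∃! _≡_ (IsNzmCode n)
  nzm-exists-unique n with valid-of-value n
  ... | w , v , refl = w , valid⇒code v ,
    λ {w′} (digs , e′ , av) →
      valid-unique n v (avoiding⇒valid w′ digs av) refl e′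

  nzm : ℕ → Word
  nzm n = proj₁ (nzm-exists-unique n)

  #sons : Colour → ℕ
  #sons white = p ∸ 2
  #sons black = p ∸ 3

  -- The admissible positions for the black son of ν depend on the colour of ν,
  -- which itself depends on the choices made at earlier nodes. Hence a position
  -- is given for both possible colours of ν; only the one for the actual colour
  -- is ever used.
  record Assignment : Set where
    field
      position : ℕ → Colour → ℕ
      bounds   : ∀ ν c → 1 ≤ position ν c × position ν c ≤ #sons c

  open Assignment

  ρ : Assignment
  ρ .position ν c   = #sons c
  ρ .bounds ν black = 1≤d , ≤-refl
  ρ .bounds ν white = ≤-trans 1≤d (<⇒≤ d<x) , ≤-refl

  -- The situation when some node is about to be processed: fresh is the
  -- smallest unused integer, queue lists the colours of that node and of the
  -- following ones up to fresh - 1.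
  record State : Set where
    constructor state
    field
      fresh : ℕ
      queue : List⁺ Colour

  open State

  sonColour : Assignment → ℕ → Colour → ℕ → Colour
  sonColour α ν c k = if k ≡ᵇ position α ν c then black else white

  -- The colours of the sons at positions 1, …, #sons c (and #sons c ≥ 1).
  sonColours : Assignment → ℕ → Colour → List⁺ Colour
  sonColours α ν c = List⁺.map (sonColour α ν c) (1 ∷ (2 ‥ #sons c))

  process : Assignment → ℕ → State → State
  process α ν (state f (c ∷ q)) = state (f + #sons c) (q ++⁺ sonColours α ν c)

  -- Nodes are positive; the value at 0 is irrelevant.
  before : Assignment → ℕ → State
  before α 0             = state 2 (black ∷ [])
  before α 1             = state 2 (black ∷ [])
  before α (suc (suc n)) = process α (suc n) (before α (suc n))

  colour : Assignment → ℕ → Colour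
  colour α ν = List⁺.head (queue (before α ν))

  sons : Assignment → ℕ → List ℕ
  sons α ν = applyUpTo (fresh (before α ν) +_) (#sons (colour α ν))

  PreferredSonProperty : Assignment → ℕ → Set
  PreferredSonProperty α a = ∀ ν → 1 ≤ ν →
    ∃! _≡_ (λ s → s ∈ sons α ν × nzm s ≡ nzm ν ▹ a)

{-# OPTIONS --safe #-}
module Submission where

-- Let ν = n + 1 and let u be the code of n. The fresh integer when ν is
-- processed is either value (u ▹ 1) or its predecessor; the latter holds exactly
-- when ν is white with signature 1 or x. Passing from ν to ν + 1, the fresh
-- integer grows by x or d according to the colour of ν, while value (u ▹ 1)
-- grows by x or d according to whether u ▹ x is a code. Hence the invariant
-- propagates once the colours of the nodes w ▹ a are known: all are white but
-- one, whose last digit is d or x. That in turn is read off the invariant at the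
-- much smaller node value w + 1, the father of most of these nodes.
--
-- The last claim fails at the root: its sons are 2, …, p - 2, whereas a code
-- with two digits has a value of at least p - 1.

open import Data.Bool using (Bool; true; false; if_then_else_)
open import Data.Empty using (⊥-elim)
open import Data.List using (List; []; _∷_; _++_; map; take; length; applyUpTo)
open import Data.List.Membership.Propositional using (_∈_)
open import Data.List.Membership.Propositional.Properties using (∈-applyUpTo⁻)
open import Data.List.NonEmpty as List⁺ using (List⁺; _++⁺_; toList)
open import Data.List.Properties
open import Data.List.Relation.Unary.Any using (here; there)
open import Data.Maybe using (just)
open import Data.Maybe.Properties using (just-injective)
open import Data.Nat using (ℕ; zero; suc; pred; _+_; _*_; _∸_; _≤_; _<_; _≡ᵇ_; z≤n; s≤s)
open import Data.Nat.Properties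
open import Data.Product using (_×_; _,_; ∃-syntax; proj₁; proj₂)
open import Data.Sum using (_⊎_; inj₁; inj₂)
open import Function using (_∘_)
open import Relation.Binary.PropositionalEquality
open import Relation.Nullary using (¬_; contradiction; yes; no)
open import Relation.Nullary.Decidable using (dec-true; dec-false)
open import Defs

-- Lists

module _ {A : Set} where

  applyUpTo-cong : ∀ {f g : ℕ → A} n → (∀ i → i < n → f i ≡ g i) →
    applyUpTo f n ≡ applyUpTo g n
  applyUpTo-cong zero    f≗g = refl
  applyUpTo-cong (suc n) f≗g =
    cong₂ _∷_ (f≗g 0 (s≤s z≤n)) (applyUpTo-cong n λ i i<n → f≗g (suc i) (s≤s i<n))

  applyUpTo-split : ∀ (f : ℕ → A) {k n} → k < n →
    ∃[ ys ] applyUpTo f n ≡ applyUpTo f k ++ f k ∷ ys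
  applyUpTo-split f {zero}  (s≤s _) = _ , refl
  applyUpTo-split f {suc k} (s≤s k<n) with applyUpTo-split (f ∘ suc) k<n
  ... | ys , eq = ys , cong (f 0 ∷_) eq

  toList-++⁺ : ∀ (xs : List A) (ys : List⁺ A) → toList (xs ++⁺ ys) ≡ xs ++ toList ys
  toList-++⁺ []       ys = refl
  toList-++⁺ (x ∷ xs) ys = cong (x ∷_) (toList-++⁺ xs ys)

module _ (p : ℕ) (p≥5 : 5 ≤ p) where
  open Metallic p p≥5

  -- Valid words and their values

  d<x : d < x
  d<x = ≤-reflexive (sym x≡1+d)

  1≤d : 1 ≤ d
  1≤d = ≤-trans (s≤s z≤n) 2≤d

  2<x : 2 < x
  2<x = ≤-trans (s≤s 2≤d) d<x

  2≤#sons : ∀ c → 2 ≤ #sons c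
  2≤#sons black = 2≤d
  2≤#sons white = <⇒≤ 2<x

  nzm-valid : ∀ n → Valid (nzm n)
  nzm-valid n with proj₁ (proj₂ (nzm-exists-unique n))
  ... | digits , _ , avoids = avoiding⇒valid _ digits avoids

  value-nzm : ∀ n → value (nzm n) ≡ n
  value-nzm n = proj₁ (proj₂ (proj₁ (proj₂ (nzm-exists-unique n))))

  nzm-value : ∀ {w} → Valid w → nzm (value w) ≡ w
  nzm-value v = proj₂ (proj₂ (nzm-exists-unique _)) (valid⇒code v)

  nzm≡ : ∀ {w n} → Valid w → value w ≡ n → nzm n ≡ w
  nzm≡ v refl = nzm-value v

  tail-valid : ∀ {a w} → Valid (a ∷ w) → Valid w
  tail-valid (inj₁ (low _ _ v)) = v
  tail-valid (inj₁ (ext f))     = inj₁ f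
  tail-valid (inj₂ (top f))     = inj₁ f
  tail-valid (inj₂ (ext b))     = inj₂ b

  digit-cases : ∀ {a w} → Valid (a ∷ w) → (1 ≤ a × a ≤ d) ⊎ (a ≡ x × Free w)
  digit-cases (inj₁ (low 1≤a a<d _)) = inj₁ (1≤a , <⇒≤ a<d)
  digit-cases (inj₁ (ext _))         = inj₁ (1≤d , ≤-refl)
  digit-cases (inj₂ (top f))         = inj₂ (refl , f)
  digit-cases (inj₂ (ext _))         = inj₁ (1≤d , ≤-refl)

  digit≥1 : ∀ {a w} → Valid (a ∷ w) → 1 ≤ a
  digit≥1 v with digit-cases v
  ... | inj₁ (1≤a , _)  = 1≤a
  ... | inj₂ (refl , _) = <⇒≤ (<⇒≤ 2<x)

  free-digit : ∀ {a w} → Free (a ∷ w) → a < d ⊎ (a ≡ d × Free w)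
  free-digit (low _ a<d _) = inj₁ a<d
  free-digit (ext f)       = inj₂ (refl , f)

  valid-∷ : ∀ {a w} → Valid w → 1 ≤ a → a ≤ d → Valid (a ∷ w)
  valid-∷ {a} v 1≤a a≤d with m≤n⇒m<n∨m≡n a≤d | v
  ... | inj₁ a<d  | _      = inj₁ (low 1≤a a<d v)
  ... | inj₂ refl | inj₁ f = inj₁ (ext f)
  ... | inj₂ refl | inj₂ b = inj₂ (ext b)

  valid-∷-free : ∀ {a w} → Free w → 1 ≤ a → a ≤ x → Valid (a ∷ w)
  valid-∷-free {a} f 1≤a a≤x with m≤n⇒m<n∨m≡n a≤x
  ... | inj₁ a<x  = valid-∷ (inj₁ f) 1≤a (m<1+n⇒m≤n (subst (a <_) x≡1+d a<x))
  ... | inj₂ refl = inj₂ (top f)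

  -- Lowering `x` leaves `d`, which is free because only a free word takes an `x`; lowering any
  -- other digit leaves one below `d`.
  pred-free : ∀ {a w} → 1 ≤ a → Valid (suc a ∷ w) → Free (a ∷ w)
  pred-free 1≤a v with digit-cases v
  ... | inj₁ (_ , a<d) = low 1≤a a<d (tail-valid v)
  ... | inj₂ (1+a≡x , f) =
    subst (λ y → Free (y ∷ _)) (sym (suc-injective (trans 1+a≡x x≡1+d))) (ext f)

  value-∷ : ∀ a w → value (a ∷ w) ≡ a + valueFrom 1 w
  value-∷ a w = cong (_+ valueFrom 1 w) (*-identityʳ a)

  metallic-1 : metallic 1 ≡ x
  metallic-1 = *-identityʳ x

  -- Together with `shift-blocked` this measures how far `value (u ▹ 1)`, which is
  -- `suc (valueFrom 1 u)`, moves when `u` is replaced by the next code.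
  shift-free : ∀ {w} → Free w → valueFrom 1 (next w) ≡ valueFrom 1 w + x
  shift-free {w} f = trans (value-next-free 1 f) (cong (valueFrom 1 w +_) metallic-1)

  shift-blocked : ∀ {w} → Blocked w → valueFrom 1 (next w) ≡ valueFrom 1 w + d
  shift-blocked {w} b = suc-injective (begin
    suc (valueFrom 1 (next w))   ≡⟨ +-comm 1 _ ⟩
    -- `metallic₋₁ 1` is 1, which lowers the increment from `x` to `d`.
    valueFrom 1 (next w) + 1     ≡⟨ value-next-blocked 1 b ⟩
    valueFrom 1 w + metallic 1   ≡⟨ cong (valueFrom 1 w +_) (trans metallic-1 x≡1+d) ⟩
    valueFrom 1 w + suc d        ≡⟨ +-suc _ d ⟩
    suc (valueFrom 1 w + d)      ∎)
    where open ≡-Reasoning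

  valueFrom-mono : ∀ i w → valueFrom i w ≤ valueFrom (suc i) w
  valueFrom-mono i []      = z≤n
  valueFrom-mono i (a ∷ w) =
    +-mono-≤ (*-monoʳ-≤ a (metallic₋₁-mono (suc i))) (valueFrom-mono (suc i) w)

  -- Appending a digit moves every other digit to a metallic number at least as large, and the new
  -- digit adds at least 1. The induction on nodes descends along this inequality.
  value-tail< : ∀ {a w} → Valid (a ∷ w) → value w < value (a ∷ w)
  value-tail< {a} {w} v = subst (value w <_) (sym (value-∷ a w))
    (+-mono-≤ (digit≥1 v) (valueFrom-mono 0 w))

  -- The tree under an arbitrary assignment

  module _ (α : Assignment) where

    private
      queueList : ℕ → List Colour
      queueList ν = toList (State.queue (before α ν))

    -- Processing removes one node from the queue and appends as many as `fresh` gains, so the queue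
    -- always holds the nodes from the current one to `fresh - 1`.
    length-queue : ∀ n →
      length (queueList (suc n)) + suc n ≡ State.fresh (before α (suc n))
    length-queue zero    = refl
    length-queue (suc n) = begin
      length (toList (t ++⁺ s)) + suc (suc n)
        ≡⟨ cong (λ l → length l + suc (suc n)) (toList-++⁺ t s) ⟩
      length (t ++ toList s) + suc (suc n)
        ≡⟨ cong (_+ suc (suc n)) (length-++ t) ⟩
      length t + length (toList s) + suc (suc n)
        ≡⟨ cong (λ l → length t + l + suc (suc n)) length-s ⟩
      length t + k + suc (suc n)
        ≡⟨ +-assoc (length t) k _ ⟩
      length t + (k + suc (suc n))
        ≡⟨ cong (length t +_) (+-comm k _) ⟩
      length t + (suc (suc n) + k)
        ≡⟨ +-assoc (length t) _ k ⟨
      length t + suc (suc n) + k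
        ≡⟨ cong (_+ k) (+-suc (length t) (suc n)) ⟩
      suc (length t + suc n) + k
        ≡⟨ cong (_+ k) (length-queue n) ⟩
      State.fresh (before α (suc n)) + k ∎
      where
      open ≡-Reasoning
      c : Colour
      c = colour α (suc n)
      t : List Colour
      t = List⁺.tail (State.queue (before α (suc n)))
      s : List⁺ Colour
      s = sonColours α (suc n) c
      k : ℕ
      k = #sons c
      length-s : length (toList s) ≡ k
      length-s = trans (cong suc (trans (length-map _ (2 ‥ k))
          (length-applyUpTo (2 +_) (k ∸ 1))))
        (m+[n∸m]≡n (<⇒≤ (2≤#sons c)))

    -- Colours leave at the front and enter only at the back, so a waiting node moves up one place
    -- per step until it is the head.
    colour-queue : ∀ n t c ys → queueList (suc n) ≡ t ++ c ∷ ys →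
      colour α (length t + suc n) ≡ c
    colour-queue n []      c ys eq = ∷-injectiveˡ eq
    colour-queue n (_ ∷ t) c ys eq = trans
      (cong (colour α) (sym (+-suc (length t) (suc n))))
      (colour-queue (suc n) t c (ys ++ s) (begin
        queueList (suc (suc n))   ≡⟨ toList-++⁺ q _ ⟩
        q ++ s                    ≡⟨ cong (_++ s) (∷-injectiveʳ eq) ⟩
        (t ++ c ∷ ys) ++ s        ≡⟨ ++-assoc t (c ∷ ys) s ⟩
        t ++ c ∷ ys ++ s          ∎))
      where
      open ≡-Reasoning
      q s : List Colour
      q = List⁺.tail (State.queue (before α (suc n)))
      s = toList (sonColours α (suc n) (colour α (suc n)))

    sonColours-applyUpTo : ∀ ν c →
      toList (sonColours α ν c) ≡ applyUpTo (sonColour α ν c ∘ suc) (#sons c)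
    sonColours-applyUpTo ν c = begin
      f 1 ∷ map f (applyUpTo (2 +_) (#sons c ∸ 1))
        ≡⟨ cong (f 1 ∷_) (map-applyUpTo (2 +_) f (#sons c ∸ 1)) ⟩
      applyUpTo (f ∘ suc) (suc (#sons c ∸ 1))
        ≡⟨ cong (applyUpTo (f ∘ suc)) (m+[n∸m]≡n (<⇒≤ (2≤#sons c))) ⟩
      applyUpTo (f ∘ suc) (#sons c) ∎
      where
      open ≡-Reasoning
      f : ℕ → Colour
      f = sonColour α ν c

    -- Once `suc n` is processed, the colours of its sons close the queue, and `length-queue` turns
    -- a place in the queue into the number of the node.
    colour-son : ∀ n {c} k → colour α (suc n) ≡ c → k < #sons c →
      colour α (State.fresh (before α (suc n)) + k) ≡ sonColour α (suc n) c (suc k)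
    colour-son n k refl k<s
      with applyUpTo-split (sonColour α (suc n) (colour α (suc n)) ∘ suc) k<s
    ... | ys , split = trans (cong (colour α) index)
        (colour-queue (suc n) (t ++ r) (g k) ys (begin
          queueList (suc (suc n))                ≡⟨ toList-++⁺ t _ ⟩
          t ++ toList (sonColours α (suc n) c)
            ≡⟨ cong (t ++_) (trans (sonColours-applyUpTo (suc n) c) split) ⟩
          t ++ r ++ g k ∷ ys                     ≡⟨ ++-assoc t r _ ⟨
          (t ++ r) ++ g k ∷ ys                   ∎))
      where
      open ≡-Reasoning
      c : Colour
      c = colour α (suc n)
      g : ℕ → Colour
      g = sonColour α (suc n) c ∘ suc
      t r : List Colour
      t = List⁺.tail (State.queue (before α (suc n)))
      r = applyUpTo g k
      index : State.fresh (before α (suc n)) + k ≡ length (t ++ r) + suc (suc n)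
      index = begin
        State.fresh (before α (suc n)) + k    ≡⟨ cong (_+ k) (length-queue n) ⟨
        suc (length t + suc n) + k            ≡⟨ cong (_+ k) (+-suc (length t) (suc n)) ⟨
        length t + suc (suc n) + k            ≡⟨ +-assoc (length t) _ k ⟩
        length t + (suc (suc n) + k)          ≡⟨ cong (length t +_) (+-comm _ k) ⟩
        length t + (k + suc (suc n))          ≡⟨ +-assoc (length t) k _ ⟨
        length t + k + suc (suc n)            ≡⟨ cong (λ l → length t + l + suc (suc n)) (length-applyUpTo g k) ⟨
        length t + length r + suc (suc n)     ≡⟨ cong (_+ suc (suc n)) (length-++ t) ⟨
        length (t ++ r) + suc (suc n)         ∎

    no-preferred-son : ∀ a → IsDigit a → ¬ PreferredSonProperty α a
    no-preferred-son a (1≤a , _) preferred with preferred 1 ≤-refl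
    ... | s , (s∈ , code) , _ with ∈-applyUpTo⁻ (2 +_) s∈
    -- The state at the root is the same for every `α`: its sons are `2 + i` with `i < d`.
    ... | i , i<d , refl = <-irrefl refl (begin-strict
        2 + i                   ≤⟨ s≤s i<d ⟩
        suc d                   ≡⟨ x≡1+d ⟨
        x                       <⟨ m<n+m x 1≤a ⟩
        a + x                   ≡⟨ cong (a +_) (trans (+-identityʳ _) (trans (+-identityʳ _) metallic-1)) ⟨
        a + valueFrom 1 (1 ∷ [])
                                ≡⟨ value-∷ a (1 ∷ []) ⟨
        value (a ∷ 1 ∷ [])      ≡⟨ cong (λ w → value (a ∷ w)) nzm-1 ⟨
        value (nzm 1 ▹ a)       ≡⟨ cong value code ⟨
        value (nzm (2 + i))     ≡⟨ value-nzm _ ⟩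
        2 + i                   ∎)
      where
      open ≤-Reasoning
      nzm-1 : nzm 1 ≡ 1 ∷ []
      nzm-1 = nzm-value (valid-∷ (inj₁ []) ≤-refl 1≤d)

  -- Colours under the rightmost assignment

  blackIf : Bool → Colour
  blackIf b = if b then black else white

  -- The `does` field of `_≟_` on naturals is `_≡ᵇ_`, so `dec-true` and `dec-false` evaluate the
  -- test.
  black-≡ : ∀ {m n} → m ≡ n → blackIf (m ≡ᵇ n) ≡ black
  black-≡ eq = cong blackIf (dec-true (_ ≟ _) eq)

  white-≢ : ∀ {m n} → m ≢ n → blackIf (m ≡ᵇ n) ≡ white
  white-≢ neq = cong blackIf (dec-false (_ ≟ _) neq)

  black-≡⁻ : ∀ m n → blackIf (m ≡ᵇ n) ≡ black → m ≡ n
  black-≡⁻ m n eq with m ≟ n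
  ... | yes m≡n = m≡n
  ... | no  m≢n = contradiction (trans (sym eq) (white-≢ m≢n)) λ ()

  firstSon : ℕ → ℕ
  firstSon ν = State.fresh (before ρ ν)

  -- Every node has at least two sons, so the last position, the black one under `ρ`, is never the
  -- first.
  firstSon-white : ∀ n → colour ρ (firstSon (suc n)) ≡ white
  firstSon-white n = trans
    (cong (colour ρ) (sym (+-identityʳ (firstSon (suc n))))) (trans
    (colour-son ρ n 0 refl (<⇒≤ (2≤#sons c)))
    (white-≢ (<⇒≢ (2≤#sons c))))
    where
    c : Colour
    c = colour ρ (suc n)

  -- The node value (a ∷ []) with a = 1 is excluded: it is the root, which has no
  -- father.
  DigitColours : ℕ → Word → Set
  DigitColours e w = ∀ {a} → Valid (a ∷ w) → w ▹ a ≢ [] ▹ 1 →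
    colour ρ (value (a ∷ w)) ≡ blackIf (a ≡ᵇ e)

  -- Under `black-d` the word `w ▹ x` may still be a code; it is then white.
  data Row (w : Word) : Set where
    black-d : DigitColours d w → Row w
    black-x : Free w → DigitColours x w → Row w

  -- Node (a ∷ w) is the invariant at the node whose predecessor has code a ∷ w;
  -- that node has signature suc a if a ∷ w is free and 1 if it is blocked.
  -- Note that suc (valueFrom 1 u) is value (u ▹ 1).
  data Node : Word → Set where
    black-node : ∀ {a w} → Free (a ∷ w) → d ≤ suc a →
      colour ρ (suc (value (a ∷ w))) ≡ black →
      firstSon (suc (value (a ∷ w))) ≡ suc (valueFrom 1 (a ∷ w)) → Node (a ∷ w)
    middle-node : ∀ {a w} → Free (a ∷ w) → suc a < x →
      colour ρ (suc (value (a ∷ w))) ≡ white →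
      firstSon (suc (value (a ∷ w))) ≡ suc (valueFrom 1 (a ∷ w)) → Node (a ∷ w)
    x-node : ∀ {a w} → Free (a ∷ w) → suc a ≡ x →
      colour ρ (suc (value (a ∷ w))) ≡ white →
      firstSon (suc (value (a ∷ w))) ≡ valueFrom 1 (a ∷ w) → Node (a ∷ w)
    1-node : ∀ {a w} → Blocked (a ∷ w) →
      colour ρ (suc (value (a ∷ w))) ≡ white →
      firstSon (suc (value (a ∷ w))) ≡ valueFrom 1 (a ∷ w) → Node (a ∷ w)

  -- Rows read off the invariant

  firstSon-step : ∀ n {c} → colour ρ (suc n) ≡ c →
    firstSon (suc (suc n)) ≡ firstSon (suc n) + #sons c
  firstSon-step n refl = refl

  -- The equation on `f + k` places `w ▹ a` at position `suc k` among the sons of the node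
  -- `value w + 1`, and `ρ` makes only the last position black.
  colour-digit : ∀ {w c f a} k → colour ρ (suc (value w)) ≡ c →
    firstSon (suc (value w)) ≡ f → k < #sons c → f + k ≡ a + valueFrom 1 w →
    colour ρ (value (a ∷ w)) ≡ blackIf (suc k ≡ᵇ #sons c)
  colour-digit {w} {a = a} k col refl k<s eq =
    trans (cong (colour ρ) (trans (value-∷ a w) (sym eq))) (colour-son ρ (value w) k col k<s)

  -- The sons of the root are the one-digit codes from 2 to `x`, since the root itself takes the
  -- digit 1; the last one is `x`.
  row-[] : Row []
  row-[] = black-x [] colours
    where
    colours : DigitColours x []
    colours {zero} v _ = contradiction (digit≥1 v) λ ()
    colours {suc zero} v ≢1 = contradiction refl ≢1
    colours {suc (suc k)} v _ = trans
      (cong (colour ρ) (trans (value-∷ (2 + k) []) (+-identityʳ _)))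
      (trans (colour-son ρ 0 k refl k<d)
        (cong (λ y → blackIf (suc (suc k) ≡ᵇ y)) (sym x≡1+d)))
      where
      k<d : k < d
      k<d with digit-cases v
      ... | inj₁ (_ , k+2≤d) = <⇒≤ k+2≤d
      ... | inj₂ (k+2≡x , _) = ≤-reflexive (suc-injective (trans k+2≡x x≡1+d))

  -- Here w ▹ x is the first son of the node value w + 2, and a first son is never
  -- black under ρ.
  colour-x : ∀ {w c} → colour ρ (suc (value w)) ≡ c →
    firstSon (suc (value w)) + #sons c ≡ x + valueFrom 1 w →
    colour ρ (value (x ∷ w)) ≡ blackIf (x ≡ᵇ d)
  colour-x {w} col eq = trans
    (cong (colour ρ) (trans (value-∷ x w) (trans (sym eq) (sym (firstSon-step (value w) col)))))
    (trans (firstSon-white (suc (value w))) (sym (white-≢ (>⇒≢ d<x))))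

  -- The fresh integer lags one behind `value (w ▹ 1)`. Hence the first of the `x` sons comes before
  -- the words `w ▹ a`, the last son is `w ▹ d`, and `w ▹ x`, if it is a code, falls to the next
  -- node.
  row-white : ∀ {w} → colour ρ (suc (value w)) ≡ white →
    firstSon (suc (value w)) ≡ valueFrom 1 w → Row w
  row-white {w} col fr = black-d colours
    where
    colours : DigitColours d w
    colours {a} v _ with digit-cases v
    ... | inj₁ (_ , a≤d) = trans
      (colour-digit {w} {a = a} a col fr (≤-<-trans a≤d d<x) (+-comm (valueFrom 1 w) a))
      (cong (λ y → blackIf (suc a ≡ᵇ y)) x≡1+d)
    ... | inj₂ (refl , _) = colour-x {w} col
      (trans (cong (_+ x) fr) (+-comm (valueFrom 1 w) x))

  row-node : ∀ {w} → Node w → Row w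
  row-node (x-node _ _ col fr) = row-white col fr
  row-node (1-node _ col fr)   = row-white col fr
  -- No lag: the `d` sons are `w ▹ 1` to `w ▹ d`, and `w ▹ x` falls to the next node.
  row-node (black-node {b} {t} _ _ col fr) = black-d colours
    where
    w : Word
    w = b ∷ t
    colours : DigitColours d w
    colours v _ with digit-cases v
    ... | inj₁ (s≤s {n = k} z≤n , k<d) =
      colour-digit {w} {a = suc k} k col fr k<d (cong suc (+-comm (valueFrom 1 w) k))
    ... | inj₂ (refl , _) = colour-x {w} col (trans (cong (_+ d) fr)
      (trans (cong suc (+-comm (valueFrom 1 w) d)) (cong (_+ valueFrom 1 w) (sym x≡1+d))))
  -- No lag and `x` sons: the last one, hence the black one, is `w ▹ x`.
  row-node (middle-node {b} {t} f _ col fr) = black-x f colours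
    where
    w : Word
    w = b ∷ t
    digit≤x : ∀ {a} → Valid (a ∷ w) → a ≤ x
    digit≤x v with digit-cases v
    ... | inj₁ (_ , a≤d)  = ≤-trans a≤d (<⇒≤ d<x)
    ... | inj₂ (refl , _) = ≤-refl
    colours : DigitColours x w
    colours {zero}  v _ = contradiction (digit≥1 v) λ ()
    colours {suc k} v _ =
      colour-digit {w} {a = suc k} k col fr (digit≤x v) (cong suc (+-comm (valueFrom 1 w) k))

  -- Consequences of a row

  black-digit≥d : ∀ {a w} → Row w → Valid (a ∷ w) → w ▹ a ≢ [] ▹ 1 →
    colour ρ (value (a ∷ w)) ≡ black → d ≤ a
  black-digit≥d {a} (black-d cs) v ≢1 col =
    ≤-reflexive (sym (black-≡⁻ a d (trans (sym (cs v ≢1)) col)))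
  black-digit≥d {a} (black-x _ cs) v ≢1 col =
    ≤-trans (<⇒≤ d<x) (≤-reflexive (sym (black-≡⁻ a x (trans (sym (cs v ≢1)) col))))

  low-digit-white : ∀ {a w} → Row w → Valid (a ∷ w) → w ▹ a ≢ [] ▹ 1 → a < d →
    colour ρ (value (a ∷ w)) ≡ white
  low-digit-white {a} (black-d cs)   v ≢1 a<d = trans (cs v ≢1) (white-≢ (<⇒≢ a<d))
  low-digit-white {a} (black-x _ cs) v ≢1 a<d =
    trans (cs v ≢1) (white-≢ (<⇒≢ (<-trans a<d d<x)))

  digit>1⇒≢1 : ∀ {a w} → 1 < a → w ▹ a ≢ [] ▹ 1
  digit>1⇒≢1 1<a refl = <-irrefl refl 1<a

  next≢[] : ∀ w → next w ≢ []
  next≢[] []      ()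
  next≢[] (a ∷ w) eq with blocked (a ∷ w)
  next≢[] (a ∷ w) () | true
  next≢[] (a ∷ w) () | false

  -- Since a row has its black word at `d` or at `x`, white at `d` leaves only `black-x`, whose
  -- argument also supplies the freeness of `w`.
  white-d⇒black-x : ∀ {w} → Row w → Valid w → colour ρ (value (d ∷ w)) ≡ white →
    Free w × colour ρ (value (x ∷ w)) ≡ black
  white-d⇒black-x (black-d cs) v col = contradiction
    (trans (sym col) (trans (cs (valid-∷ v 1≤d ≤-refl) (digit>1⇒≢1 2≤d)) (black-≡ {d} refl))) λ ()
  white-d⇒black-x (black-x f cs) v col =
    f , trans (cs (inj₂ (top f)) (digit>1⇒≢1 (<⇒≤ 2<x))) (black-≡ {x} refl)

  black-d⇒white-x : ∀ {w} → Row w → Free w → colour ρ (value (d ∷ w)) ≡ black →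
    colour ρ (value (x ∷ w)) ≡ white
  black-d⇒white-x (black-d cs) f col =
    trans (cs (inj₂ (top f)) (digit>1⇒≢1 (<⇒≤ 2<x))) (white-≢ (>⇒≢ d<x))
  black-d⇒white-x (black-x _ cs) f col = contradiction
    (trans (sym col) (trans (cs (inj₁ (ext f)) (digit>1⇒≢1 2≤d)) (white-≢ (<⇒≢ d<x)))) λ ()

  -- Propagation of the invariant

  1-white : ∀ {a w} → Blocked (a ∷ w) → Row (next w) →
    colour ρ (suc (value (a ∷ w))) ≡ white
  1-white {a} {w} b row = trans (cong (colour ρ) node)
    -- The node is `next w ▹ 1`. Its last digit 1 is below `d`, and it is not the root because
    -- `next w` is not empty.
    (low-digit-white row (valid-∷ (next-valid (tail-valid (inj₂ b))) ≤-refl 1≤d)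
      (λ eq → next≢[] w (∷-injectiveʳ eq)) 2≤d)
    where
    node : suc (value (a ∷ w)) ≡ value (1 ∷ next w)
    node = trans (sym (value-next (inj₂ b))) (cong value (next-blocked b))

  -- As `u` is free, `value (u ▹ 1)` gains `x`: a white node preserves the lag of the fresh integer,
  -- and a black one creates a lag of one. It remains to match this with the colour and signature of
  -- the next node. Since `suc (value (a ∷ w))` computes to `value (suc a ∷ w)`, the hypothesis
  -- `col` is also the colour of a word in the row of `w`.
  node-step-free : ∀ {a w} → Free (a ∷ w) → Node (a ∷ w) → Row w → Row (next w) →
    Node (suc a ∷ w)
  node-step-free {a} {w} f node row row′ = go node
    where
    u : Word
    u = a ∷ w

    r+x : valueFrom 1 u + x ≡ valueFrom 1 (suc a ∷ w)
    r+x = trans (sym (shift-free f)) (cong (valueFrom 1) (next-free f))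

    v′ : Valid (suc a ∷ w)
    v′ = subst Valid (next-free f) (next-valid (inj₁ f))

    go : Node u → Node (suc a ∷ w)
    go (1-node b _ _) = contradiction
      (trans (sym (blocked-blocked b)) (free-unblocked f)) λ ()
    -- A code ending in `x` is blocked, so the next signature is 1 and the lag persists.
    go (x-node _ 1+a≡x col fr) with v′
    ... | inj₂ b = 1-node b (1-white b row′)
      (trans (firstSon-step (value u) col) (trans (cong (_+ x) fr) r+x))
    ... | inj₁ g with free-digit g
    ...   | inj₁ 1+a<d       = contradiction 1+a≡x (<⇒≢ (<-trans 1+a<d d<x))
    ...   | inj₂ (1+a≡d , _) = contradiction (trans (sym 1+a≡d) 1+a≡x) (<⇒≢ d<x)
    -- The black node ends in `d` or `x`. If its code is blocked, the next signature is 1. Otherwise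
    -- it is `w ▹ d`, and the next node `w ▹ x` is white because the row already has its black word.
    go (black-node _ d≤1+a col fr) = after-black v′
      where
      fr′ : firstSon (suc (suc (value u))) ≡ valueFrom 1 (suc a ∷ w)
      fr′ = trans (firstSon-step (value u) col) (trans (cong (_+ d) fr)
        (trans (sym (+-suc _ d)) (trans (cong (valueFrom 1 u +_) (sym x≡1+d)) r+x)))
      after-black : Valid (suc a ∷ w) → Node (suc a ∷ w)
      after-black (inj₂ b) = 1-node b (1-white b row′) fr′
      after-black (inj₁ g) with free-digit g
      ... | inj₁ 1+a<d       = contradiction d≤1+a (<⇒≱ 1+a<d)
      ... | inj₂ (1+a≡d , h) = x-node g 2+a≡x
        (subst (λ y → colour ρ (value (y ∷ w)) ≡ white) (sym 2+a≡x)
          (black-d⇒white-x row h (subst (λ y → colour ρ (value (y ∷ w)) ≡ black) 1+a≡d col))) fr′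
        where
        2+a≡x : suc (suc a) ≡ x
        2+a≡x = trans (cong suc 1+a≡d) (sym x≡1+d)
    go (middle-node _ 1+a<x col fr) =
      middle (m≤n⇒m<n∨m≡n (m<1+n⇒m≤n (subst (suc a <_) x≡1+d 1+a<x)))
      where
      fr′ : firstSon (suc (suc (value u))) ≡ suc (valueFrom 1 (suc a ∷ w))
      fr′ = trans (firstSon-step (value u) col) (trans (cong (_+ x) fr) (cong suc r+x))
      middle : suc a < d ⊎ suc a ≡ d → Node (suc a ∷ w)
      -- The last digit of the next node is at most `d`. Its colour is left open; if it is black,
      -- the row makes that digit at least `d`.
      middle (inj₁ 1+a<d) with colour ρ (suc (value (suc a ∷ w))) in col′
      ... | black = black-node (low (s≤s z≤n) 1+a<d (tail-valid (inj₁ f)))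
        (black-digit≥d row (valid-∷ (tail-valid (inj₁ f)) (s≤s z≤n) 1+a<d)
          (digit>1⇒≢1 (s≤s (s≤s z≤n))) col′)
        col′ fr′
      ... | white = middle-node (low (s≤s z≤n) 1+a<d (tail-valid (inj₁ f)))
        (≤-<-trans 1+a<d d<x) col′ fr′
      -- The white node is `w ▹ d`, so the next one, `w ▹ x`, is the black word of the row.
      middle (inj₂ 1+a≡d) with white-d⇒black-x row (tail-valid (inj₁ f))
        (subst (λ y → colour ρ (value (y ∷ w)) ≡ white) 1+a≡d col)
      ... | g , col′ = black-node (subst (λ y → Free (y ∷ w)) (sym 1+a≡d) (ext g))
        (≤-trans (≤-reflexive (sym 1+a≡d)) (n≤1+n _))
        (subst (λ y → colour ρ (value (y ∷ w)) ≡ black) (trans x≡1+d (cong suc (sym 1+a≡d))) col′)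
        fr′

  -- Only a `1-node` can carry a blocked word. There the white node adds `x` to the fresh integer
  -- while `value (u ▹ 1)` gains only `d`, which cancels the lag.
  node-step-blocked : ∀ {a w} → Blocked (a ∷ w) → Node (a ∷ w) → Row (next w) →
    Node (1 ∷ next w)
  node-step-blocked b (black-node f _ _ _)  _ =
    contradiction (trans (sym (blocked-blocked b)) (free-unblocked f)) λ ()
  node-step-blocked b (middle-node f _ _ _) _ =
    contradiction (trans (sym (blocked-blocked b)) (free-unblocked f)) λ ()
  node-step-blocked b (x-node f _ _ _)      _ =
    contradiction (trans (sym (blocked-blocked b)) (free-unblocked f)) λ ()
  node-step-blocked {a} {w} b (1-node _ col fr) row = go
    where
    vw : Valid (next w)
    vw = next-valid (tail-valid (inj₂ b))
    next-u : next (a ∷ w) ≡ 1 ∷ next w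
    next-u = next-blocked b
    fr′ : firstSon (suc (value (1 ∷ next w))) ≡ suc (valueFrom 1 (1 ∷ next w))
    fr′ = begin
      firstSon (suc (value (1 ∷ next w)))
        ≡⟨ cong (firstSon ∘ suc) (trans (cong value (sym next-u)) (value-next (inj₂ b))) ⟩
      firstSon (suc (suc (value (a ∷ w))))   ≡⟨ firstSon-step (value (a ∷ w)) col ⟩
      firstSon (suc (value (a ∷ w))) + x     ≡⟨ cong₂ _+_ fr x≡1+d ⟩
      valueFrom 1 (a ∷ w) + suc d            ≡⟨ +-suc _ d ⟩
      suc (valueFrom 1 (a ∷ w) + d)          ≡⟨ cong suc (shift-blocked b) ⟨
      suc (valueFrom 1 (next (a ∷ w)))       ≡⟨ cong (suc ∘ valueFrom 1) next-u ⟩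
      suc (valueFrom 1 (1 ∷ next w))         ∎
      where open ≡-Reasoning
    go : Node (1 ∷ next w)
    -- This node ends in 2, which is `d` when `p` is 5, so black cannot be excluded.
    go with colour ρ (suc (value (1 ∷ next w))) in col′
    ... | black = black-node (low ≤-refl 2≤d vw)
      (black-digit≥d row (valid-∷ vw (s≤s z≤n) 2≤d) (digit>1⇒≢1 ≤-refl) col′) col′ fr′
    ... | white = middle-node (low ≤-refl 2≤d vw) 2<x col′ fr′

  -- The induction

  node-1 : Node (1 ∷ [])
  node-1 = middle-node (low ≤-refl 2≤d (inj₁ [])) 2<x (firstSon-white 0)
    (cong suc (sym (trans (+-identityʳ _) (trans (+-identityʳ _) (trans metallic-1 x≡1+d)))))

  mutual
    -- The bound `n` serves as fuel. The invariant at a word calls for the one at the preceding code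
    -- `b ∷ w₀` and for the rows of `w₀` and `next w₀`, all of smaller value.
    node≤ : ∀ n {a w} → Valid (a ∷ w) → value (a ∷ w) ≤ n → Node (a ∷ w)
    node≤ zero    v le = contradiction (≤-trans (value-tail< v) le) λ ()
    node≤ (suc n) v le with valid-pred v
    ... | []     , _  , refl = node-1
    ... | b ∷ w₀ , v₀ , eq   = subst Node eq (step v₀)
      where
      le₀ : value (b ∷ w₀) ≤ n
      le₀ = m<1+n⇒m≤n (≤-trans (≤-reflexive (trans (sym (value-next v₀)) (cong value eq)))
        le)
      vt : Valid w₀
      vt = tail-valid v₀
      row-next : Row (next w₀)
      row-next = row≤ n (next-valid vt)
        (≤-trans (≤-reflexive (value-next vt)) (≤-trans (value-tail< v₀) le₀))
      step : Valid (b ∷ w₀) → Node (next (b ∷ w₀))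
      step (inj₁ f) = subst Node (sym (next-free f))
        (node-step-free f (node≤ n v₀ le₀)
          (row≤ n vt (<⇒≤ (≤-trans (value-tail< v₀) le₀))) row-next)
      step (inj₂ bl) = subst Node (sym (next-blocked bl))
        (node-step-blocked bl (node≤ n v₀ le₀) row-next)

    row≤ : ∀ n {w} → Valid w → value w ≤ n → Row w
    row≤ n {[]}    v le = row-[]
    row≤ n {a ∷ w} v le = row-node (node≤ n v le)

  node : ∀ {a w} → Valid (a ∷ w) → Node (a ∷ w)
  node v = node≤ _ v ≤-refl

  -- Codes of the sons

  SonCodes : ℕ → Set
  SonCodes ν =
    let u = nzm (ν ∸ 1)
        v = nzm (ν ∸ 2)
        sonCodes = map nzm (sons ρ ν)
    in
    (ν ≡ 1 →
      sonCodes ≡ map (λ h → [] ▹ (h + 1)) (1 ‥ (p ∸ 4)) ++ ([] ▹ x) ∷ [])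
    × (ν ≢ 1 → colour ρ ν ≡ black →
      sonCodes ≡ map (λ h → u ▹ h) (1 ‥ (p ∸ 3)))
    × (colour ρ ν ≡ white →
      signature (nzm ν) ≡ just 1 ⊎ signature (nzm ν) ≡ just x →
      sonCodes ≡ (v ▹ x) ∷ map (λ h → u ▹ (h ∸ 1)) (2 ‥ (p ∸ 2)))
    × (colour ρ ν ≡ white →
      ∀ a → signature (nzm ν) ≡ just a → 1 < a → a < x →
      sonCodes ≡ map (λ h → u ▹ h) (1 ‥ (p ∸ 3)) ++ (u ▹ x) ∷ [])

  -- Codes are unique, so it is enough to exhibit valid words with consecutive values.
  map-nzm : ∀ {f n} g → (∀ i → i < n → Valid (g i) × value (g i) ≡ f + i) →
    map nzm (applyUpTo (f +_) n) ≡ applyUpTo g n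
  map-nzm {f} {n} g codes = trans (map-applyUpTo (f +_) nzm n)
    (applyUpTo-cong n λ i i<n → nzm≡ (proj₁ (codes i i<n)) (proj₂ (codes i i<n)))

  map-nzm-sons : ∀ n {f c} g → colour ρ (suc n) ≡ c → firstSon (suc n) ≡ f →
    (∀ i → i < #sons c → Valid (g i) × value (g i) ≡ f + i) →
    map nzm (sons ρ (suc n)) ≡ applyUpTo g (#sons c)
  map-nzm-sons n g refl refl codes = map-nzm g codes

  value-row : ∀ w i → value (suc i ∷ w) ≡ suc (valueFrom 1 w) + i
  value-row w i = trans (value-∷ (suc i) w) (cong suc (+-comm i _))

  row-snoc : ∀ u →
    applyUpTo (λ i → u ▹ suc i) x ≡ map (λ h → u ▹ h) (1 ‥ d) ++ (u ▹ x) ∷ []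
  row-snoc u = begin
    applyUpTo g x                              ≡⟨ cong (applyUpTo g) x≡1+d ⟩
    applyUpTo g (suc d)                        ≡⟨ applyUpTo-∷ʳ g d ⟨
    applyUpTo g d ++ (u ▹ suc d) ∷ []
      ≡⟨ cong₂ (λ l y → l ++ (u ▹ y) ∷ []) (map-applyUpTo (1 +_) (u ▹_) d) x≡1+d ⟨
    map (u ▹_) (1 ‥ d) ++ (u ▹ x) ∷ []         ∎
    where
    open ≡-Reasoning
    g : ℕ → Word
    g i = u ▹ suc i

  sonCodes-root : map nzm (sons ρ 1) ≡ map (λ h → [] ▹ (h + 1)) (1 ‥ (p ∸ 4)) ++ ([] ▹ x) ∷ []
  sonCodes-root = begin
    map nzm (sons ρ 1)                               ≡⟨ map-nzm-sons 0 g refl refl codes ⟩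
    applyUpTo g d                                    ≡⟨ cong (applyUpTo g) d≡1+e ⟩
    applyUpTo g (suc e)                              ≡⟨ applyUpTo-∷ʳ g e ⟨
    applyUpTo g e ++ ([] ▹ suc (suc e)) ∷ []
      ≡⟨ cong₂ (λ l y → l ++ ([] ▹ y) ∷ [])
           (trans (map-applyUpTo (1 +_) _ e)
             (applyUpTo-cong e λ i _ → cong (λ y → [] ▹ suc y) (+-comm i 1)))
           (trans x≡1+d (cong suc d≡1+e)) ⟨
    map (λ h → [] ▹ (h + 1)) (1 ‥ e) ++ ([] ▹ x) ∷ [] ∎
    where
    open ≡-Reasoning
    e : ℕ
    e = p ∸ 4
    d≡1+e : d ≡ suc e
    d≡1+e = +-∸-assoc 1 (≤-trans (n≤1+n 4) p≥5)
    g : ℕ → Word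
    g i = [] ▹ suc (suc i)
    codes : ∀ i → i < d → Valid (g i) × value (g i) ≡ 2 + i
    codes i i<d = valid-∷-free [] (s≤s z≤n) (subst (suc (suc i) ≤_) (sym x≡1+d) (s≤s i<d))
      , trans (value-∷ (suc (suc i)) []) (+-identityʳ _)

  -- With `u` the word `suc a ∷ w`, the word `v` given by `a ∷ w` is free and precedes it. Hence
  -- `value (v ▹ x)` is `valueFrom 1 v + x`, that is `valueFrom 1 u`, the lagging fresh integer.
  -- From the second son on, the codes are `u ▹ 1`, `u ▹ 2` and so on.
  sonCodes-shifted : ∀ {a w} → 1 ≤ a → Valid (suc a ∷ w) →
    colour ρ (suc (value (suc a ∷ w))) ≡ white →
    firstSon (suc (value (suc a ∷ w))) ≡ valueFrom 1 (suc a ∷ w) →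
    map nzm (sons ρ (suc (value (suc a ∷ w))))
      ≡ (nzm (value (a ∷ w)) ▹ x) ∷ map (λ h → nzm (value (suc a ∷ w)) ▹ (h ∸ 1)) (2 ‥ x)
  sonCodes-shifted {a} {w} 1≤a valid col fr = begin
    map nzm (sons ρ (suc (value u)))   ≡⟨ map-nzm-sons (value u) g col fr codes ⟩
    applyUpTo g x                      ≡⟨ cong (applyUpTo g) x≡1+d ⟩
    (v ▹ x) ∷ applyUpTo (g ∘ suc) d
      ≡⟨ cong₂ (λ v u → (v ▹ x) ∷ applyUpTo (λ i → u ▹ suc i) d) (nzm-value (inj₁ f)) (nzm-value valid) ⟨
    (nzm (value v) ▹ x) ∷ applyUpTo (λ i → nzm (value u) ▹ suc i) d
      ≡⟨ cong ((nzm (value v) ▹ x) ∷_)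
           (trans (map-applyUpTo (2 +_) _ (x ∸ 1)) (cong (applyUpTo _) (cong pred x≡1+d))) ⟨
    (nzm (value v) ▹ x) ∷ map (λ h → nzm (value u) ▹ (h ∸ 1)) (2 ‥ x) ∎
    where
    open ≡-Reasoning
    u v : Word
    u = suc a ∷ w
    v = a ∷ w
    f : Free v
    f = pred-free 1≤a valid
    g : ℕ → Word
    g zero    = v ▹ x
    g (suc i) = u ▹ suc i
    codes : ∀ i → i < x → Valid (g i) × value (g i) ≡ valueFrom 1 u + i
    codes zero    _     = inj₂ (top f) , (begin
      value (x ∷ v)            ≡⟨ value-∷ x v ⟩
      x + valueFrom 1 v        ≡⟨ +-comm x _ ⟩
      valueFrom 1 v + x        ≡⟨ shift-free f ⟨
      valueFrom 1 (next v)     ≡⟨ cong (valueFrom 1) (next-free f) ⟩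
      valueFrom 1 u            ≡⟨ +-identityʳ _ ⟨
      valueFrom 1 u + 0        ∎)
    codes (suc i) 1+i<x =
      valid-∷ valid (s≤s z≤n) (m<1+n⇒m≤n (subst (suc i <_) x≡1+d 1+i<x)) ,
      trans (value-row u i) (sym (+-suc _ i))

  signature-next : ∀ {w} → Valid w → signature (nzm (suc (value w))) ≡ signature (next w)
  signature-next v = cong signature (nzm≡ (next-valid v) (value-next v))

  -- Each constructor of `Node` settles one clause. The others are refuted by the colour, by the
  -- signature, which is the last digit of `next w`, or, for the root clause, by `value w` being
  -- positive.
  sonCodes : ∀ {w} → Valid w → Node w → SonCodes (suc (value w))
  sonCodes valid (black-node {a} {w} f _ col fr) =
      (λ eq → contradiction (suc-injective eq) (m<n⇒n≢0 (value-tail< valid)))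
    , (λ _ _ → trans (map-nzm-sons (value u) (λ i → u ▹ suc i) col fr λ i i<d →
          valid-∷ valid (s≤s z≤n) i<d , value-row u i)
        (sym (trans (map-applyUpTo (1 +_) _ d)
          (cong (λ z → applyUpTo (λ i → z ▹ suc i) d) (nzm-value valid)))))
    , (λ col′ → contradiction (trans (sym col) col′) λ ())
    , (λ col′ → contradiction (trans (sym col) col′) λ ())
    where
    u : Word
    u = a ∷ w
  sonCodes valid (middle-node {a} {w} f 1+a<x col fr) =
      (λ eq → contradiction (suc-injective eq) (m<n⇒n≢0 (value-tail< valid)))
    , (λ _ col′ → contradiction (trans (sym col) col′) λ ())
    , (λ _ sig → ⊥-elim (impossible sig))
    , (λ _ _ _ _ _ → trans (map-nzm-sons (value u) (λ i → u ▹ suc i) col fr λ i i<x →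
          valid-∷-free f (s≤s z≤n) i<x , value-row u i)
        (trans (row-snoc u) (cong (λ z → map (λ h → z ▹ h) (1 ‥ d) ++ (z ▹ x) ∷ [])
          (sym (nzm-value valid)))))
    where
    u : Word
    u = a ∷ w
    sig-u : signature (nzm (suc (value u))) ≡ just (suc a)
    sig-u = trans (signature-next valid) (cong signature (next-free f))
    impossible : ¬ (signature (nzm (suc (value u))) ≡ just 1
      ⊎ signature (nzm (suc (value u))) ≡ just x)
    impossible (inj₁ eq) = <⇒≢ (s≤s (digit≥1 valid)) (sym (just-injective (trans (sym sig-u) eq)))
    impossible (inj₂ eq) = <⇒≢ 1+a<x (just-injective (trans (sym sig-u) eq))
  sonCodes valid (x-node {zero} f 1≡x col fr) = contradiction 1≡x (<⇒≢ (<⇒≤ 2<x))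
  sonCodes valid (x-node {suc a} {w} f 2+a≡x col fr) =
      (λ eq → contradiction (suc-injective eq) (m<n⇒n≢0 (value-tail< valid)))
    , (λ _ col′ → contradiction (trans (sym col) col′) λ ())
    , (λ _ _ → sonCodes-shifted 1≤a valid col fr)
    , (λ _ b sig _ b<x → contradiction
        (just-injective (trans (sym sig) (trans (signature-next valid) (cong signature (next-free f)))))
        λ b≡2+a → <⇒≢ b<x (trans b≡2+a 2+a≡x))
    where
    1≤a : 1 ≤ a
    1≤a = m<1+n⇒m≤n (m<1+n⇒m≤n (subst (3 ≤_) (sym 2+a≡x) 2<x))
  sonCodes valid (1-node {zero} b col fr) = contradiction (digit≥1 valid) λ ()
  sonCodes valid (1-node {suc a} {w} b col fr) =
      (λ eq → contradiction (suc-injective eq) (m<n⇒n≢0 (value-tail< valid)))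
    , (λ _ col′ → contradiction (trans (sym col) col′) λ ())
    , (λ _ _ → sonCodes-shifted (m<1+n⇒m≤n (blocked≥2 b)) valid col fr)
    , (λ _ c sig 1<c → contradiction
        (just-injective (trans (sym sig)
          (trans (signature-next valid) (cong signature (next-blocked b)))))
        (>⇒≢ 1<c))
    where
    -- A blocked word ends in `d` or `x`, so lowering its last digit still leaves a digit.
    blocked≥2 : ∀ {c t} → Blocked (c ∷ t) → 2 ≤ c
    blocked≥2 (top _) = <⇒≤ 2<x
    blocked≥2 (ext _) = 2≤d

  all-sonCodes : ∀ ν → 1 ≤ ν → SonCodes ν
  all-sonCodes (suc zero) _ =
      (λ _ → sonCodes-root)
    , (λ 1≢1 → contradiction refl 1≢1)
    , (λ ())
    , (λ ())
  all-sonCodes (suc (suc n)) _ = go (nzm-valid (suc n)) (value-nzm (suc n))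
    where
    go : ∀ {w m} → Valid w → value w ≡ suc m → SonCodes (suc (suc m))
    go {a ∷ w} valid eq = subst (SonCodes ∘ suc) eq (sonCodes valid (node valid))

  -- The successor among the sons

  take-2-sons : ∀ ν → take 2 (sons ρ ν) ≡ (firstSon ν + 0) ∷ (firstSon ν + 1) ∷ []
  take-2-sons ν with #sons (colour ρ ν) | 2≤#sons (colour ρ ν)
  ... | suc (suc _) | s≤s (s≤s _) = refl

  -- Without lag `value (w ▹ 1)` is the fresh integer itself, and with lag the integer after it.
  firstSon-cases : ∀ {w} → Node w →
    value (1 ∷ w) ≡ firstSon (suc (value w)) + 0 ⊎ value (1 ∷ w) ≡ firstSon (suc (value w)) + 1
  firstSon-cases (black-node _ _ _ fr)  = inj₁ (sym (trans (+-identityʳ _) fr))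
  firstSon-cases (middle-node _ _ _ fr) = inj₁ (sym (trans (+-identityʳ _) fr))
  firstSon-cases (x-node _ _ _ fr)      = inj₂ (sym (trans (+-comm _ 1) (cong suc fr)))
  firstSon-cases (1-node _ _ fr)        = inj₂ (sym (trans (+-comm _ 1) (cong suc fr)))

  successor-son : ∀ ν → 1 ≤ ν → ∃[ s ] nzm s ≡ nzm ν ▹ 1 × s ∈ take 2 (sons ρ (ν + 1))
  successor-son (suc n) _ = go (nzm-valid (suc n)) (value-nzm (suc n))
    where
    member : ∀ {s m n : ℕ} → s ≡ m ⊎ s ≡ n → s ∈ m ∷ n ∷ []
    member (inj₁ s≡m) = here s≡m
    member (inj₂ s≡n) = there (here s≡n)
    go : ∀ {w m} → Valid w → value w ≡ suc m →
      ∃[ s ] nzm s ≡ w ▹ 1 × s ∈ take 2 (sons ρ (suc m + 1))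
    go {a ∷ w} {m} valid eq =
      -- The invariant indexed by the code `a ∷ w` of the given node is the one at the following
      -- node, whose sons are wanted.
      value (1 ∷ a ∷ w) , nzm-value (valid-∷ valid ≤-refl 1≤d) ,
      subst (value (1 ∷ a ∷ w) ∈_) (sym (trans (cong (take 2 ∘ sons ρ) ν+1) (take-2-sons ν)))
        (member (firstSon-cases (node valid)))
      where
      ν : ℕ
      ν = suc (value (a ∷ w))
      ν+1 : suc m + 1 ≡ ν
      ν+1 = trans (+-comm (suc m) 1) (cong suc (sym eq))

theorem15 : (p : ℕ) (p≥5 : 5 ≤ p) →
    let open Metallic p p≥5 in
    (∀ ν → 1 ≤ ν →
      let u = nzm (ν ∸ 1)
          v = nzm (ν ∸ 2)
          sonCodes = map nzm (sons ρ ν)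
      in
      (ν ≡ 1 →
        sonCodes ≡ map (λ h → [] ▹ (h + 1)) (1 ‥ (p ∸ 4)) ++ ([] ▹ x) ∷ [])
      × (ν ≢ 1 → colour ρ ν ≡ black →
        sonCodes ≡ map (λ h → u ▹ h) (1 ‥ (p ∸ 3)))
      × (colour ρ ν ≡ white →
        signature (nzm ν) ≡ just 1 ⊎ signature (nzm ν) ≡ just x →
        sonCodes ≡ (v ▹ x) ∷ map (λ h → u ▹ (h ∸ 1)) (2 ‥ (p ∸ 2)))
      × (colour ρ ν ≡ white →
        ∀ a → signature (nzm ν) ≡ just a → 1 < a → a < x →
        sonCodes ≡ map (λ h → u ▹ h) (1 ‥ (p ∸ 3)) ++ (u ▹ x) ∷ []))
    × (∀ a → IsDigit a → ¬ PreferredSonProperty ρ a)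
    × (∀ ν → 1 ≤ ν →
        ∃[ s ] nzm s ≡ nzm ν ▹ 1 × s ∈ take 2 (sons ρ (ν + 1)))
    × (∀ α a → IsDigit a → ¬ PreferredSonProperty α a)
theorem15 p p≥5 =
    all-sonCodes p p≥5
  , no-preferred-son p p≥5 (Metallic.ρ p p≥5)
  , successor-son p p≥5
  , no-preferred-son p p≥5
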